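{- Let $G$ and $H$ be groups with finite generating sets $S$ and $T$ respectively, and suppose there exists a snake embedding $\phi:G\to H$ (with respect to $S$ and $T$). Then the infinite snake problem for $(G,S)$ many-one reduces to the infinite snake problem for $(H,T)$, and the ouroboros problem for $(G,S)$ many-one reduces to the ouroboros problem for $(H,T)$.
   Context: An invertible-reversible transducer is a tuple $\mathcal{M}=(Q,S,T,q_0,\delta,\eta)$ with $Q$ a finite set of states, $S,T$ finite alphabets, $q_0\in Q$, $\delta:Q\times S\to Q$, $\eta:Q\times S\to T$ with $\eta(q,\cdot)$ injective for every $q$, and such that for all $q\in Q$, $s\in S$ there is a unique $q'$ with $\delta(q',s)=q$. It is extended to inverses by $\delta(q,s^{ -1})=q'$ and $\eta(q,s^{ -1})=\eta(q',s)^{ -1}$, where $q'$ is the unique state with $\delta(q',s)=q$. For a word $w$ over $S\cup S^{ -1}$, $q_w$ is the state reached from $q_0$ after reading $w$. Define $f_{\mathcal{M}}:(S\cup S^{ -1})^*\to(T\cup T^{ -1})^*$ by $f_{\mathcal{M}}(\epsilon)=\epsilon$ and $f_{\mathcal{M}}(ws^{\pm1})=f_{\mathcal{M}}(w)\eta(q_w,s^{\pm1})$. A map $\phi:G\to H$ is a snake embedding if there is such a transducer $\mathcal{M}$ with $\phi(g)$ equal to the element of $H$ represented by $f_{\mathcal{M}}(w)$ for every word $w$ representing $g$, and $f_{\mathcal{M}}(w)=_H f_{\mathcal{M}}(w')$ if and only if $w=_G w'$. For a group $K$ with finite generating set $U$: a tileset graph is a finite multigraph $\Gamma=(A,B)$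 with edges triples $(a,a',s)$, $s\in U\cup U^{ -1}$, closed under $(a,a',s)\mapsto(a',a,s^{ -1})$. A $\Gamma$-snake on $I\in\{\mathbb{Z},\mathbb{N},\llbracket n,m\rrbracket\}$ is a pair $(\omega,\zeta)$, $\omega:I\to K$ injective, $\zeta:I\to A$, with $d\omega_i:=\omega(i)^{ -1}\omega(i+1)\in U\cup U^{ -1}$ and $(\zeta(i),\zeta(i+1),d\omega_i)\in B$; bi-infinite if $I=\mathbb{Z}$. A $\Gamma$-ouroboros is such a pair on $\llbracket 0,n\rrbracket$, $n\ge2$, with $\omega$ injective except $\omega(0)=\omega(n)$. The infinite snake (resp. ouroboros) problem for $(K,U)$: given $\Gamma$, decide whether a bi-infinite $\Gamma$-snake (resp. a $\Gamma$-ouroboros) exists. -}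

module Defs where

open import Level using (Level; _⊔_) renaming (suc to lsuc)
open import Algebra.Bundles using (Group)
open import Data.Nat using (ℕ; _≤_)
open import Data.Fin using (Fin; inject₁; fromℕ) renaming (zero to fzero; suc to fsuc)
open import Data.Integer using (ℤ) renaming (suc to zsuc)
open import Data.List using (List; []; _∷_)
open import Data.List.Membership.Propositional using (_∈_)
open import Data.Product using (Σ; ∃; ∃-syntax; ∃!; _×_; _,_; proj₁)
open import Data.Sum using (_⊎_)
open import Function.Bundles using (_⇔_)
open import Relation.Binary.PropositionalEquality using (_≡_)

data Sym (k : ℕ) : Set where
  _⁺ : Fin k → Sym k
  _⁻ : Fin k → Sym k

invSym : ∀ {k} → Sym k → Sym k
invSym (s ⁺) = s ⁻
invSym (s ⁻) = s ⁺

Word : ℕ → Set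
Word k = List (Sym k)

module _ {c ℓ} (G : Group c ℓ) {k : ℕ} (gen : Fin k → Group.Carrier G) where
  open Group G

  symVal : Sym k → Carrier
  symVal (s ⁺) = gen s
  symVal (s ⁻) = gen s ⁻¹

  evalWord : Word k → Carrier
  evalWord []      = ε
  evalWord (x ∷ w) = symVal x ∙ evalWord w

-- A group together with a finite generating set S (S = image of an
-- injective map from the finite alphabet Fin rank)

record GenGroup (c ℓ : Level) : Set (lsuc (c ⊔ ℓ)) where
  field
    group : Group c ℓ
    rank  : ℕ
    gen   : Fin rank → Group.Carrier group
  open Group group
  field
    gen-injective : ∀ {s t} → gen s ≈ gen t → s ≡ t
    generates     : ∀ (g : Carrier) → ∃[ w ] (evalWord group gen w ≈ g)

  Elt : Set c
  Elt = Carrier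

  ⟦_⟧ : Word rank → Carrier
  ⟦ w ⟧ = evalWord group gen w

  ⟦_⟧ˢ : Sym rank → Carrier
  ⟦ x ⟧ˢ = symVal group gen x

record Transducer (k l : ℕ) : Set where
  field
    nQ    : ℕ
    q₀    : Fin nQ
    δ     : Fin nQ → Fin k → Fin nQ
    η     : Fin nQ → Fin k → Fin l
    η-inj : ∀ q {s t} → η q s ≡ η q t → s ≡ t
    δ-pre : ∀ q s → ∃! _≡_ (λ q' → δ q' s ≡ q)

  pre : Fin nQ → Fin k → Fin nQ
  pre q s = proj₁ (δ-pre q s)

  δ± : Fin nQ → Sym k → Fin nQ
  δ± q (s ⁺) = δ q s
  δ± q (s ⁻) = pre q s

  η± : Fin nQ → Sym k → Sym l
  η± q (s ⁺) = η q s ⁺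
  η± q (s ⁻) = η (pre q s) s ⁻

  run : Fin nQ → Word k → Word l
  run q []      = []
  run q (x ∷ w) = η± q x ∷ run (δ± q x) w

  fM : Word k → Word l
  fM = run q₀

module _ {c ℓ c' ℓ'} (G : GenGroup c ℓ) (H : GenGroup c' ℓ') where
  private
    module G = GenGroup G
    module H = GenGroup H
    module GG = Group G.group
    module HG = Group H.group

  IsSnakeEmbedding : (G.Elt → H.Elt) → Set (c ⊔ ℓ ⊔ ℓ')
  IsSnakeEmbedding φ = Σ (Transducer G.rank H.rank) λ M →
    let open Transducer M in
      (∀ (g : G.Elt) (w : Word G.rank) → G.⟦ w ⟧ GG.≈ g → H.⟦ fM w ⟧ HG.≈ φ g)
    × (∀ (w w' : Word G.rank) → (H.⟦ fM w ⟧ HG.≈ H.⟦ fM w' ⟧) ⇔ (G.⟦ w ⟧ GG.≈ G.⟦ w' ⟧))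

record TilesetGraph (k : ℕ) : Set where
  field
    nA     : ℕ
    edges  : List (Fin nA × Fin nA × Sym k)
    closed : ∀ {a a' s} → (a , a' , s) ∈ edges → (a' , a , invSym s) ∈ edges

module _ {c ℓ} (K : GenGroup c ℓ) where
  open GenGroup K
  open Group group

  Step : (Γ : TilesetGraph rank) → (ω₁ ω₂ : Carrier)
       → (ζ₁ ζ₂ : Fin (TilesetGraph.nA Γ)) → Set ℓ
  Step Γ ω₁ ω₂ ζ₁ ζ₂ = ∃[ s ] ((ω₁ ⁻¹ ∙ ω₂ ≈ ⟦ s ⟧ˢ) × ((ζ₁ , ζ₂ , s) ∈ TilesetGraph.edges Γ))

  HasBiInfiniteSnake : TilesetGraph rank → Set (c ⊔ ℓ)
  HasBiInfiniteSnake Γ =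
    Σ (ℤ → Carrier) λ ω → Σ (ℤ → Fin (TilesetGraph.nA Γ)) λ ζ →
        (∀ i j → ω i ≈ ω j → i ≡ j)
      × (∀ i → Step Γ (ω i) (ω (zsuc i)) (ζ i) (ζ (zsuc i)))

  HasOuroboros : TilesetGraph rank → Set (c ⊔ ℓ)
  HasOuroboros Γ =
    ∃[ n ] (2 ≤ n × (Σ (Fin (Data.Nat.suc n) → Carrier) λ ω → Σ (Fin (Data.Nat.suc n) → Fin (TilesetGraph.nA Γ)) λ ζ →
        (ω fzero ≈ ω (fromℕ n))
      × (∀ i j → ω i ≈ ω j →
           (i ≡ j) ⊎ ((i ≡ fzero × j ≡ fromℕ n) ⊎ (i ≡ fromℕ n × j ≡ fzero)))
      × (∀ (i : Fin n) → Step Γ (ω (inject₁ i)) (ω (fsuc i)) (ζ (inject₁ i)) (ζ (fsuc i)))))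

-- Many-one reductions: a (total, hence computable) Agda function between
-- instances preserving and reflecting membership

ManyOneReduces : ∀ {a b p q} {X : Set a} {Y : Set b}
               → (X → Set p) → (Y → Set q) → Set (a ⊔ b ⊔ p ⊔ q)
ManyOneReduces {X = X} {Y = Y} P Q = Σ (X → Y) λ f → ∀ x → P x ⇔ Q (f x)

{-# OPTIONS --safe #-}

-- Pair the tiles of Γ with states of the transducer: an edge (a, a', s) of Γ read in state q
-- becomes an edge from (a, q) to (a', δ±(q, s)) labelled by the output η±(q, s). Feeding the
-- letters of a Γ-walk in G through the transducer gives a walk of the lifted graph in H, and
-- conversely a lifted walk in H spells out, starting from a word that reaches its first state,
-- a Γ-walk in G. In a group, which positions of a walk coincide depends only on its increments,
-- so each walk has the same coincidences as the walk of words spelling it, and the snake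
-- embedding preserves and reflects equality of words.

module Submission where

open import Defs
open import Algebra.Bundles using (Group)
open import Level using (_⊔_; Setω)
open import Data.Nat using (ℕ; zero; suc; _*_; s≤s; z≤n)
open import Data.Fin using (Fin; inject₁; combine; remQuot) renaming (zero to fzero; suc to fsuc)
open import Data.Fin.Properties using (any?; remQuot-combine)
open import Data.Fin.Subset using (Subset; ⁅_⁆; _∪_; _⊆_; _⊂_; _⊃_) renaming (_∈_ to _∈ₛ_; _∉_ to _∉ₛ_)
open import Data.Fin.Subset.Properties using (x∈⁅x⁆; x∈⁅y⁆⇒x≡y; ⊆-trans; p⊆p∪q; q⊆p∪q; x∈p∪q⁻) renaming (_∈?_ to _∈ₛ?_)
open import Data.Fin.Subset.Induction using (⊃-wellFounded)
open import Induction.WellFounded using (Acc; acc)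
open import Data.Integer using (ℤ; +_; -[1+_]) renaming (suc to zsuc)
open import Data.List using (List; []; _∷_; _++_; [_]; map; filter; allFin; cartesianProduct)
open import Data.List.Membership.Propositional using (_∈_; find; lose)
open import Data.List.Membership.Propositional.Properties using (∈-++⁺ˡ; ∈-++⁺ʳ; ∈-map⁺; ∈-map⁻; ∈-filter⁺; ∈-filter⁻; ∈-allFin; ∈-cartesianProduct⁺; ∈-cartesianProduct⁻)
open import Data.List.Relation.Unary.Any using (Any) renaming (any? to anyᴸ?)
open import Data.Product using (_×_; Σ-syntax; ∃-syntax; _,_; proj₁; proj₂)
open import Data.Sum using (_⊎_; inj₁; inj₂)
open import Function.Base using (_∘_)
open import Function.Bundles using (_⇔_; mk⇔; Equivalence)
open import Function.Construct.Composition using (_⇔-∘_)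
open import Function.Construct.Symmetry using (⇔-sym)
open import Relation.Nullary using (yes; no; ¬?)
open import Relation.Nullary.Decidable using (_×-dec_; decidable-stable)
open import Relation.Binary.PropositionalEquality using (_≡_; refl; sym; trans; cong; subst; subst₂; module ≡-Reasoning)
import Algebra.Properties.Group as GroupProperties
import Relation.Binary.Reasoning.Setoid as SetoidReasoning

-- v represents w x: either x is appended to w, or x⁻¹ is removed from the end of w.
data Adjacent {k} : Word k → Sym k → Word k → Set where
  append : ∀ {w x} → Adjacent w x (w ++ [ x ])
  remove : ∀ {w x} → Adjacent (w ++ [ x ]) (invSym x) w

remove-invSym : ∀ {k} {w : Word k} x → Adjacent (w ++ [ invSym x ]) x w
remove-invSym (s ⁺) = remove
remove-invSym (s ⁻) = remove

allSym : ∀ k → List (Sym k)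
allSym k = map _⁺ (allFin k) ++ map _⁻ (allFin k)

∈-allSym : ∀ {k} (x : Sym k) → x ∈ allSym k
∈-allSym     (s ⁺) = ∈-++⁺ˡ (∈-map⁺ _⁺ (∈-allFin s))
∈-allSym {k} (s ⁻) = ∈-++⁺ʳ (map _⁺ (allFin k)) (∈-map⁺ _⁻ (∈-allFin s))

module _ {c ℓ} (K : GenGroup c ℓ) where
  open GenGroup K
  open Group group renaming (refl to ≈-refl; sym to ≈-sym; trans to ≈-trans)
  open GroupProperties group using (y≈x\\z; \\-leftDividesʳ; //-rightDividesʳ; ⁻¹-involutive)
  open SetoidReasoning setoid

  ⟦⟧-++ : ∀ w v → ⟦ w ++ v ⟧ ≈ ⟦ w ⟧ ∙ ⟦ v ⟧
  ⟦⟧-++ []      v = ≈-sym (identityˡ _)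
  ⟦⟧-++ (x ∷ w) v = ≈-trans (∙-congˡ (⟦⟧-++ w v)) (≈-sym (assoc _ _ _))

  ⟦⟧-snoc : ∀ w x → ⟦ w ++ [ x ] ⟧ ≈ ⟦ w ⟧ ∙ ⟦ x ⟧ˢ
  ⟦⟧-snoc w x = ≈-trans (⟦⟧-++ w [ x ]) (∙-congˡ (identityʳ _))

  ⟦invSym⟧ : ∀ x → ⟦ invSym x ⟧ˢ ≈ ⟦ x ⟧ˢ ⁻¹
  ⟦invSym⟧ (s ⁺) = ≈-refl
  ⟦invSym⟧ (s ⁻) = ≈-sym (⁻¹-involutive _)

  adjacent-increment : ∀ {w x v} → Adjacent w x v → ⟦ w ⟧ \\ ⟦ v ⟧ ≈ ⟦ x ⟧ˢ
  adjacent-increment (append {w} {x}) = begin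
    ⟦ w ⟧ \\ ⟦ w ++ [ x ] ⟧    ≈⟨ ∙-congˡ (⟦⟧-snoc w x) ⟩
    ⟦ w ⟧ \\ (⟦ w ⟧ ∙ ⟦ x ⟧ˢ)  ≈⟨ \\-leftDividesʳ _ _ ⟩
    ⟦ x ⟧ˢ                      ∎
  adjacent-increment (remove {w} {x}) = ≈-sym (y≈x\\z _ _ _ (begin
    ⟦ w ++ [ x ] ⟧ ∙ ⟦ invSym x ⟧ˢ  ≈⟨ ∙-cong (⟦⟧-snoc w x) (⟦invSym⟧ x) ⟩
    ⟦ w ⟧ ∙ ⟦ x ⟧ˢ ∙ ⟦ x ⟧ˢ ⁻¹     ≈⟨ //-rightDividesʳ _ _ ⟩
    ⟦ w ⟧                           ∎))

-- prefix u s i is u followed by the letters s along the links from the origin to i, inverted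
-- when a link is crossed backwards.
record PathShape : Setω where
  field
    Pos Link        : Set
    src tgt         : Link → Pos
    origin          : Pos
    origin-link     : Link
    src-origin-link : src origin-link ≡ origin
    connected       : ∀ {p} (P : Pos → Set p) → P origin →
                      (∀ e → P (src e) → P (tgt e)) → (∀ e → P (tgt e) → P (src e)) → ∀ i → P i
    prefix          : ∀ {k} → Word k → (Link → Sym k) → Pos → Word k
    prefix-origin   : ∀ {k} (u : Word k) s → prefix u s origin ≡ u
    prefix-adjacent : ∀ {k} (u : Word k) s e → Adjacent (prefix u s (src e)) (s e) (prefix u s (tgt e))

ℤ-induction : ∀ {p} (P : ℤ → Set p) → P (+ 0) →
              (∀ i → P i → P (zsuc i)) → (∀ i → P (zsuc i) → P i) → ∀ i → P i
ℤ-induction P P₀ up down (+ zero)     = P₀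
ℤ-induction P P₀ up down (+ suc n)    = up (+ n) (ℤ-induction P P₀ up down (+ n))
ℤ-induction P P₀ up down -[1+ zero ]  = down -[1+ zero ] P₀
ℤ-induction P P₀ up down -[1+ suc n ] = down -[1+ suc n ] (ℤ-induction P P₀ up down -[1+ n ])

ℤ-prefix : ∀ {k} → Word k → (ℤ → Sym k) → ℤ → Word k
ℤ-prefix u s (+ zero)     = u
ℤ-prefix u s (+ suc n)    = ℤ-prefix u s (+ n) ++ [ s (+ n) ]
ℤ-prefix u s -[1+ zero ]  = u ++ [ invSym (s -[1+ zero ]) ]
ℤ-prefix u s -[1+ suc n ] = ℤ-prefix u s -[1+ n ] ++ [ invSym (s -[1+ suc n ]) ]

ℤ-prefix-adjacent : ∀ {k} (u : Word k) s i → Adjacent (ℤ-prefix u s i) (s i) (ℤ-prefix u s (zsuc i))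
ℤ-prefix-adjacent u s (+ n)        = append
ℤ-prefix-adjacent u s -[1+ zero ]  = remove-invSym (s -[1+ zero ])
ℤ-prefix-adjacent u s -[1+ suc n ] = remove-invSym (s -[1+ suc n ])

ℤ-line : PathShape
ℤ-line = record
  { Pos             = ℤ
  ; Link            = ℤ
  ; src             = λ i → i
  ; tgt             = zsuc
  ; origin          = + 0
  ; origin-link     = + 0
  ; src-origin-link = refl
  ; connected       = ℤ-induction
  ; prefix          = ℤ-prefix
  ; prefix-origin   = λ _ _ → refl
  ; prefix-adjacent = ℤ-prefix-adjacent
  }

Fin-induction : ∀ n {p} (P : Fin (suc n) → Set p) → P fzero →
                (∀ e → P (inject₁ e) → P (fsuc e)) → ∀ i → P i
Fin-induction n       P P₀ up fzero    = P₀
Fin-induction (suc n) P P₀ up (fsuc i) = Fin-induction n (P ∘ fsuc) (up fzero P₀) (up ∘ fsuc) i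

Fin-prefix : ∀ {k} n → Word k → (Fin n → Sym k) → Fin (suc n) → Word k
Fin-prefix n       u s fzero    = u
Fin-prefix (suc n) u s (fsuc i) = Fin-prefix n (u ++ [ s fzero ]) (s ∘ fsuc) i

Fin-prefix-adjacent : ∀ {k} n (u : Word k) s e →
                      Adjacent (Fin-prefix n u s (inject₁ e)) (s e) (Fin-prefix n u s (fsuc e))
Fin-prefix-adjacent (suc n) u s fzero    = append
Fin-prefix-adjacent (suc n) u s (fsuc e) = Fin-prefix-adjacent n (u ++ [ s fzero ]) (s ∘ fsuc) e

-- Positions ⟦0, m+1⟧, so that there is a link out of the origin.
segment : ℕ → PathShape
segment m = record
  { Pos             = Fin (suc (suc m))
  ; Link            = Fin (suc m)
  ; src             = inject₁
  ; tgt             = fsuc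
  ; origin          = fzero
  ; origin-link     = fzero
  ; src-origin-link = refl
  ; connected       = λ P P₀ up _ → Fin-induction (suc m) P P₀ up
  ; prefix          = Fin-prefix (suc m)
  ; prefix-origin   = λ _ _ → refl
  ; prefix-adjacent = Fin-prefix-adjacent (suc m)
  }

module _ {c ℓ} (K : GenGroup c ℓ) (Sh : PathShape) (Γ : TilesetGraph (GenGroup.rank K)) where
  open GenGroup K
  open PathShape Sh

  IsGraphWalk : (Pos → Elt) → (Pos → Fin (TilesetGraph.nA Γ)) → Set ℓ
  IsGraphWalk ω ζ = ∀ e → Step K Γ (ω (src e)) (ω (tgt e)) (ζ (src e)) (ζ (tgt e))

module _ (Sh : PathShape) {c ℓ} (K : Group c ℓ) where
  open PathShape Sh
  open Group K renaming (refl to ≈-refl; sym to ≈-sym; trans to ≈-trans)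
  open GroupProperties K using (∙-cancelˡ; ∙-cancelʳ; \\-leftDividesˡ)
  open SetoidReasoning setoid

  \\-chain : ∀ x y z → (x \\ y) ∙ (y \\ z) ≈ x \\ z
  \\-chain x y z = ≈-trans (assoc _ _ _) (∙-congˡ (\\-leftDividesˡ y z))

  module _ (a b : Pos → Carrier)
           (same-increments : ∀ e → a (src e) \\ a (tgt e) ≈ b (src e) \\ b (tgt e)) where

    same-displacements : ∀ i → a origin \\ a i ≈ b origin \\ b i
    same-displacements = connected _ (≈-trans (inverseˡ _) (≈-sym (inverseˡ _))) forward backward
      where
        forward : ∀ e → a origin \\ a (src e) ≈ b origin \\ b (src e) →
                  a origin \\ a (tgt e) ≈ b origin \\ b (tgt e)
        forward e d = begin
          a origin \\ a (tgt e)                                ≈⟨ \\-chain _ _ _ ⟨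
          (a origin \\ a (src e)) ∙ (a (src e) \\ a (tgt e))  ≈⟨ ∙-cong d (same-increments e) ⟩
          (b origin \\ b (src e)) ∙ (b (src e) \\ b (tgt e))  ≈⟨ \\-chain _ _ _ ⟩
          b origin \\ b (tgt e)                                ∎
        backward : ∀ e → a origin \\ a (tgt e) ≈ b origin \\ b (tgt e) →
                   a origin \\ a (src e) ≈ b origin \\ b (src e)
        backward e d = ∙-cancelʳ (a (src e) \\ a (tgt e)) _ _ (begin
          (a origin \\ a (src e)) ∙ (a (src e) \\ a (tgt e))  ≈⟨ \\-chain _ _ _ ⟩
          a origin \\ a (tgt e)                                ≈⟨ d ⟩
          b origin \\ b (tgt e)                                ≈⟨ \\-chain _ _ _ ⟨
          (b origin \\ b (src e)) ∙ (b (src e) \\ b (tgt e))  ≈⟨ ∙-congˡ (same-increments e) ⟨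
          (b origin \\ b (src e)) ∙ (a (src e) \\ a (tgt e))  ∎)

    same-increments⇒same-coincidences : ∀ i j → (a i ≈ a j) ⇔ (b i ≈ b j)
    same-increments⇒same-coincidences i j = mk⇔
      (λ aᵢ≈aⱼ → ∙-cancelˡ (b origin ⁻¹) _ _ (begin
        b origin \\ b i  ≈⟨ same-displacements i ⟨
        a origin \\ a i  ≈⟨ ∙-congˡ aᵢ≈aⱼ ⟩
        a origin \\ a j  ≈⟨ same-displacements j ⟩
        b origin \\ b j  ∎))
      (λ bᵢ≈bⱼ → ∙-cancelˡ (a origin ⁻¹) _ _ (begin
        a origin \\ a i  ≈⟨ same-displacements i ⟩
        b origin \\ b i  ≈⟨ ∙-congˡ bᵢ≈bⱼ ⟩
        b origin \\ b j  ≈⟨ same-displacements j ⟨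
        a origin \\ a j  ∎))

module _ {n} (next : Fin n → List (Fin n)) where

  Closed : Subset n → Set
  Closed p = ∀ {q q'} → q ∈ₛ p → q' ∈ next q → q' ∈ₛ p

  closed-or-escapes : ∀ p → Closed p ⊎ ∃[ q ] (q ∈ₛ p × Any (_∉ₛ p) (next q))
  closed-or-escapes p with any? (λ q → (q ∈ₛ? p) ×-dec anyᴸ? (λ q' → ¬? (q' ∈ₛ? p)) (next q))
  ... | yes escape = inj₂ escape
  ... | no ¬escape = inj₁ λ {q} {q'} q∈p q'∈next →
    decidable-stable (q' ∈ₛ? p) (λ q'∉p → ¬escape (q , q∈p , lose q'∈next q'∉p))

  ClosedSupersetWithin : (Fin n → Set) → Subset n → Set
  ClosedSupersetWithin R p = Σ[ p' ∈ Subset n ] (Closed p' × p ⊆ p' × (∀ {q} → q ∈ₛ p' → R q))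

  closed-superset-within : (R : Fin n → Set) → (∀ {q q'} → R q → q' ∈ next q → R q') →
                           ∀ {p} → (∀ {q} → q ∈ₛ p → R q) → ClosedSupersetWithin R p
  closed-superset-within R R-next {p} = go p (⊃-wellFounded p)
    where
      go : ∀ p → Acc _⊃_ p → (∀ {q} → q ∈ₛ p → R q) → ClosedSupersetWithin R p
      go p (acc larger) p⊆R with closed-or-escapes p
      ... | inj₁ closed = p , closed , (λ q∈p → q∈p) , p⊆R
      ... | inj₂ (q , q∈p , escape) = grow (find escape)
        where
          grow : ∃[ q' ] (q' ∈ next q × q' ∉ₛ p) → ClosedSupersetWithin R p
          grow (q' , q'∈next , q'∉p) =
            let p' , closed , p∪q'⊆p' , p'⊆R = go (p ∪ ⁅ q' ⁆) (larger p⊂p∪q') p∪q'⊆R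
            in  p' , closed , ⊆-trans (p⊆p∪q ⁅ q' ⁆) p∪q'⊆p' , p'⊆R
            where
              p⊂p∪q' : p ⊂ p ∪ ⁅ q' ⁆
              p⊂p∪q' = p⊆p∪q ⁅ q' ⁆ , q' , q⊆p∪q p ⁅ q' ⁆ (x∈⁅x⁆ q') , q'∉p

              p∪q'⊆R : ∀ {r} → r ∈ₛ p ∪ ⁅ q' ⁆ → R r
              p∪q'⊆R r∈ with x∈p∪q⁻ p ⁅ q' ⁆ r∈
              ... | inj₁ r∈p  = p⊆R r∈p
              ... | inj₂ r∈q' rewrite x∈⁅y⁆⇒x≡y q' r∈q' = R-next (p⊆R q∈p) q'∈next

module TransducerProperties {k l} (M : Transducer k l) where
  open Transducer M

  δ* : Fin nQ → Word k → Fin nQ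
  δ* q []      = q
  δ* q (x ∷ w) = δ* (δ± q x) w

  δ*-++ : ∀ q w v → δ* q (w ++ v) ≡ δ* (δ* q w) v
  δ*-++ q []      v = refl
  δ*-++ q (x ∷ w) v = δ*-++ (δ± q x) w v

  run-++ : ∀ q w v → run q (w ++ v) ≡ run q w ++ run (δ* q w) v
  run-++ q []      v = refl
  run-++ q (x ∷ w) v = cong (η± q x ∷_) (run-++ (δ± q x) w v)

  pre∘δ : ∀ q s → pre (δ q s) s ≡ q
  pre∘δ q s = proj₂ (proj₂ (δ-pre (δ q s) s)) refl

  δ∘pre : ∀ q s → δ (pre q s) s ≡ q
  δ∘pre q s = proj₁ (proj₂ (δ-pre q s))

  δ±-invSym : ∀ q x → δ± (δ± q x) (invSym x) ≡ q
  δ±-invSym q (s ⁺) = pre∘δ q s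
  δ±-invSym q (s ⁻) = δ∘pre q s

  η±-invSym : ∀ q x → η± (δ± q x) (invSym x) ≡ invSym (η± q x)
  η±-invSym q (s ⁺) = cong (λ p → η p s ⁻) (pre∘δ q s)
  η±-invSym q (s ⁻) = refl

  δ±-injective : ∀ {p q} x → δ± p x ≡ δ± q x → p ≡ q
  δ±-injective {p} {q} x eq =
    trans (sym (δ±-invSym p x)) (trans (cong (λ r → δ± r (invSym x)) eq) (δ±-invSym q x))

  δ*-adjacent : ∀ q {w x v} → Adjacent w x v → δ* q v ≡ δ± (δ* q w) x
  δ*-adjacent q (append {w} {x}) = δ*-++ q w [ x ]
  δ*-adjacent q (remove {w} {x}) =
    sym (trans (cong (λ r → δ± r (invSym x)) (δ*-++ q w [ x ])) (δ±-invSym (δ* q w) x))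

  run-adjacent : ∀ q {w x v} → Adjacent w x v → Adjacent (run q w) (η± (δ* q w) x) (run q v)
  run-adjacent q (append {w} {x}) rewrite run-++ q w [ x ] = append
  run-adjacent q (remove {w} {x}) rewrite run-++ q w [ x ] | δ*-++ q w [ x ] | η±-invSym (δ* q w) x = remove

  Reachable : Fin nQ → Set
  Reachable q = ∃[ w ] δ* q₀ w ≡ q

  successors : Fin nQ → List (Fin nQ)
  successors q = map (δ± q) (allSym k)

  private
    reachable-successor : ∀ {q q'} → Reachable q → q' ∈ successors q → Reachable q'
    reachable-successor (w , refl) q'∈ with ∈-map⁻ _ q'∈
    ... | x , _ , refl = w ++ [ x ] , δ*-++ q₀ w [ x ]

    reachable-closure : ClosedSupersetWithin successors Reachable ⁅ q₀ ⁆
    reachable-closure = closed-superset-within successors Reachable reachable-successor {⁅ q₀ ⁆}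
                          (λ q∈ → [] , sym (x∈⁅y⁆⇒x≡y q₀ q∈))

  reachable : Subset nQ
  reachable = proj₁ reachable-closure

  reachable-sound : ∀ {q} → q ∈ₛ reachable → Reachable q
  reachable-sound = proj₂ (proj₂ (proj₂ reachable-closure))

  δ±-reachable : ∀ {q} x → q ∈ₛ reachable → δ± q x ∈ₛ reachable
  δ±-reachable x q∈ = proj₁ (proj₂ reachable-closure) q∈ (∈-map⁺ _ (∈-allSym x))

  δ*-reachable : ∀ {q} w → q ∈ₛ reachable → δ* q w ∈ₛ reachable
  δ*-reachable []      q∈ = q∈
  δ*-reachable (x ∷ w) q∈ = δ*-reachable w (δ±-reachable x q∈)

  q₀-reachable : q₀ ∈ₛ reachable
  q₀-reachable = proj₁ (proj₂ (proj₂ reachable-closure)) (x∈⁅x⁆ q₀)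

module LiftedGraph {k l} (M : Transducer k l) (Γ : TilesetGraph k) where
  open Transducer M
  open TransducerProperties M
  open TilesetGraph Γ

  tileOf : Fin (nA * nQ) → Fin nA
  tileOf u = proj₁ (remQuot {nA} nQ u)

  stateOf : Fin (nA * nQ) → Fin nQ
  stateOf u = proj₂ (remQuot {nA} nQ u)

  tileOf-combine : ∀ (a : Fin nA) (q : Fin nQ) → tileOf (combine a q) ≡ a
  tileOf-combine a q = cong proj₁ (remQuot-combine {nA} {nQ} a q)

  stateOf-combine : ∀ (a : Fin nA) (q : Fin nQ) → stateOf (combine a q) ≡ q
  stateOf-combine a q = cong proj₂ (remQuot-combine {nA} {nQ} a q)

  liftEdge : (Fin nA × Fin nA × Sym k) × Fin nQ → Fin (nA * nQ) × Fin (nA * nQ) × Sym l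
  liftEdge ((a , a' , x) , q) = combine a q , combine a' (δ± q x) , η± q x

  reachableStates : List (Fin nQ)
  reachableStates = filter (_∈ₛ? reachable) (allFin nQ)

  liftedEdges : List (Fin (nA * nQ) × Fin (nA * nQ) × Sym l)
  liftedEdges = map liftEdge (cartesianProduct edges reachableStates)

  ∈-liftedEdges⁺ : ∀ {e q} → e ∈ edges → q ∈ₛ reachable → liftEdge (e , q) ∈ liftedEdges
  ∈-liftedEdges⁺ e∈ q∈ =
    ∈-map⁺ liftEdge (∈-cartesianProduct⁺ e∈ (∈-filter⁺ (_∈ₛ? reachable) (∈-allFin _) q∈))

  ∈-liftedEdges⁻ : ∀ {y} → y ∈ liftedEdges →
                   ∃[ e ] ∃[ q ] (e ∈ edges × q ∈ₛ reachable × y ≡ liftEdge (e , q))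
  ∈-liftedEdges⁻ y∈ with ∈-map⁻ liftEdge y∈
  ... | (e , q) , eq∈ , refl with ∈-cartesianProduct⁻ edges reachableStates eq∈
  ... | e∈ , q∈ = e , q , e∈ , proj₂ (∈-filter⁻ (_∈ₛ? reachable) {xs = allFin nQ} q∈) , refl

  liftedEdges-closed : ∀ {u u' t} → (u , u' , t) ∈ liftedEdges → (u' , u , invSym t) ∈ liftedEdges
  liftedEdges-closed y∈ with ∈-liftedEdges⁻ y∈
  ... | (a , a' , x) , q , e∈ , q∈ , refl =
    subst (_∈ liftedEdges) reversed (∈-liftedEdges⁺ (closed e∈) (δ±-reachable x q∈))
    where
      reversed : liftEdge ((a' , a , invSym x) , δ± q x) ≡ (combine a' (δ± q x) , combine a q , invSym (η± q x))
      reversed rewrite δ±-invSym q x | η±-invSym q x = refl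

  liftedGraph : TilesetGraph l
  liftedGraph = record { nA = nA * nQ ; edges = liftedEdges ; closed = liftedEdges-closed }

  record Lifting (u u' : Fin (nA * nQ)) (t : Sym l) : Set where
    field
      letter           : Sym k
      base-edge        : (tileOf u , tileOf u' , letter) ∈ edges
      source-reachable : stateOf u ∈ₛ reachable
      target-state     : stateOf u' ≡ δ± (stateOf u) letter
      output           : t ≡ η± (stateOf u) letter

  lifting : ∀ {u u' t} → (u , u' , t) ∈ liftedEdges → Lifting u u' t
  lifting y∈ with ∈-liftedEdges⁻ y∈
  ... | (a , a' , x) , q , e∈ , q∈ , refl = record
    { letter           = x
    ; base-edge        = subst₂ (λ b b' → (b , b' , x) ∈ edges)
                                (sym (tileOf-combine a q)) (sym (tileOf-combine a' (δ± q x))) e∈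
    ; source-reachable = subst (_∈ₛ reachable) (sym (stateOf-combine a q)) q∈
    ; target-state     = trans (stateOf-combine a' (δ± q x)) (cong (λ r → δ± r x) (sym (stateOf-combine a q)))
    ; output           = cong (λ r → η± r x) (sym (stateOf-combine a q))
    }

module SnakeTransfer {c ℓ c' ℓ'} (G : GenGroup c ℓ) (H : GenGroup c' ℓ')
                     (φ : GenGroup.Elt G → GenGroup.Elt H) (embedding : IsSnakeEmbedding G H φ) where
  private
    module G = GenGroup G
    module H = GenGroup H
    module GG = Group G.group
    module HG = Group H.group
    M : Transducer G.rank H.rank
    M = proj₁ embedding

  open Transducer M
  open TransducerProperties M

  faithful : ∀ w w' → (H.⟦ fM w ⟧ HG.≈ H.⟦ fM w' ⟧) ⇔ (G.⟦ w ⟧ GG.≈ G.⟦ w' ⟧)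
  faithful = proj₂ (proj₂ embedding)

  SameCoincidences : ∀ {Pos : Set} → (Pos → G.Elt) → (Pos → H.Elt) → Set (ℓ ⊔ ℓ')
  SameCoincidences ω ω' = ∀ i j → (ω i GG.≈ ω j) ⇔ (ω' i HG.≈ ω' j)

  module _ (Sh : PathShape) (Γ : TilesetGraph G.rank) where
    open PathShape Sh
    open LiftedGraph M Γ

    lift-walk : ∀ {ω ζ} → IsGraphWalk G Sh Γ ω ζ →
      Σ[ ω' ∈ (Pos → H.Elt) ] Σ[ ζ' ∈ (Pos → Fin (TilesetGraph.nA liftedGraph)) ]
        (SameCoincidences ω ω' × IsGraphWalk H Sh liftedGraph ω' ζ')
    lift-walk {ω} {ζ} walk = ω' , ζ' , coincide , walk'
      where
        s : Link → Sym G.rank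
        s e = proj₁ (walk e)

        W : Pos → Word G.rank
        W = prefix [] s

        adjacent : ∀ e → Adjacent (W (src e)) (s e) (W (tgt e))
        adjacent = prefix-adjacent [] s

        ω' : Pos → H.Elt
        ω' i = H.⟦ fM (W i) ⟧

        ζ' : Pos → Fin (TilesetGraph.nA liftedGraph)
        ζ' i = combine (ζ i) (δ* q₀ (W i))

        increments : ∀ e → ω (src e) GG.\\ ω (tgt e) GG.≈ G.⟦ W (src e) ⟧ GG.\\ G.⟦ W (tgt e) ⟧
        increments e = GG.trans (proj₁ (proj₂ (walk e))) (GG.sym (adjacent-increment G (adjacent e)))

        coincide : SameCoincidences ω ω'
        coincide i j = ⇔-sym (faithful (W i) (W j))
                   ⇔-∘ same-increments⇒same-coincidences Sh G.group ω (G.⟦_⟧ ∘ W) increments i j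

        walk' : IsGraphWalk H Sh liftedGraph ω' ζ'
        walk' e = η± q (s e) , adjacent-increment H (run-adjacent q₀ (adjacent e)) , lifted-edge
          where
            q : Fin nQ
            q = δ* q₀ (W (src e))
            lifted-edge : (ζ' (src e) , ζ' (tgt e) , η± q (s e)) ∈ liftedEdges
            lifted-edge = subst (λ r → (ζ' (src e) , combine (ζ (tgt e)) r , η± q (s e)) ∈ liftedEdges)
                                (sym (δ*-adjacent q₀ (adjacent e)))
                                (∈-liftedEdges⁺ (proj₂ (proj₂ (walk e))) (δ*-reachable (W (src e)) q₀-reachable))

    project-walk : ∀ {ω' ζ'} → IsGraphWalk H Sh liftedGraph ω' ζ' →
      Σ[ ω ∈ (Pos → G.Elt) ] Σ[ ζ ∈ (Pos → Fin (TilesetGraph.nA Γ)) ]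
        (SameCoincidences ω ω' × IsGraphWalk G Sh Γ ω ζ)
    project-walk {ω'} {ζ'} walk' = ω , ζ , coincide , walk
      where
        lift : ∀ e → Lifting (ζ' (src e)) (ζ' (tgt e)) (proj₁ (walk' e))
        lift e = lifting (proj₂ (proj₂ (walk' e)))

        s : Link → Sym G.rank
        s e = Lifting.letter (lift e)

        start : Reachable (stateOf (ζ' origin))
        start = reachable-sound (subst (λ i → stateOf (ζ' i) ∈ₛ reachable) src-origin-link
                                       (Lifting.source-reachable (lift origin-link)))

        V : Pos → Word G.rank
        V = prefix (proj₁ start) s

        adjacent : ∀ e → Adjacent (V (src e)) (s e) (V (tgt e))
        adjacent = prefix-adjacent (proj₁ start) s

        ω : Pos → G.Elt
        ω i = G.⟦ V i ⟧

        ζ : Pos → Fin (TilesetGraph.nA Γ)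
        ζ i = tileOf (ζ' i)

        tracks : ∀ i → δ* q₀ (V i) ≡ stateOf (ζ' i)
        tracks = connected _ (trans (cong (δ* q₀) (prefix-origin _ s)) (proj₂ start)) forward backward
          where
            open ≡-Reasoning
            forward : ∀ e → δ* q₀ (V (src e)) ≡ stateOf (ζ' (src e)) →
                      δ* q₀ (V (tgt e)) ≡ stateOf (ζ' (tgt e))
            forward e h = begin
              δ* q₀ (V (tgt e))                ≡⟨ δ*-adjacent q₀ (adjacent e) ⟩
              δ± (δ* q₀ (V (src e))) (s e)     ≡⟨ cong (λ q → δ± q (s e)) h ⟩
              δ± (stateOf (ζ' (src e))) (s e)  ≡⟨ Lifting.target-state (lift e) ⟨
              stateOf (ζ' (tgt e))             ∎
            backward : ∀ e → δ* q₀ (V (tgt e)) ≡ stateOf (ζ' (tgt e)) →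
                       δ* q₀ (V (src e)) ≡ stateOf (ζ' (src e))
            backward e h = δ±-injective (s e) (begin
              δ± (δ* q₀ (V (src e))) (s e)     ≡⟨ δ*-adjacent q₀ (adjacent e) ⟨
              δ* q₀ (V (tgt e))                ≡⟨ h ⟩
              stateOf (ζ' (tgt e))             ≡⟨ Lifting.target-state (lift e) ⟩
              δ± (stateOf (ζ' (src e))) (s e)  ∎)

        output-tracks : ∀ e → η± (δ* q₀ (V (src e))) (s e) ≡ proj₁ (walk' e)
        output-tracks e = trans (cong (λ q → η± q (s e)) (tracks (src e))) (sym (Lifting.output (lift e)))

        increments : ∀ e → H.⟦ fM (V (src e)) ⟧ HG.\\ H.⟦ fM (V (tgt e)) ⟧ HG.≈ ω' (src e) HG.\\ ω' (tgt e)
        increments e = begin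
          H.⟦ fM (V (src e)) ⟧ HG.\\ H.⟦ fM (V (tgt e)) ⟧  ≈⟨ adjacent-increment H (run-adjacent q₀ (adjacent e)) ⟩
          H.⟦ η± (δ* q₀ (V (src e))) (s e) ⟧ˢ              ≡⟨ cong H.⟦_⟧ˢ (output-tracks e) ⟩
          H.⟦ proj₁ (walk' e) ⟧ˢ                           ≈⟨ proj₁ (proj₂ (walk' e)) ⟨
          ω' (src e) HG.\\ ω' (tgt e)                      ∎
          where open SetoidReasoning HG.setoid

        coincide : SameCoincidences ω ω'
        coincide i j = same-increments⇒same-coincidences Sh H.group (H.⟦_⟧ ∘ fM ∘ V) ω' increments i j
                   ⇔-∘ ⇔-sym (faithful (V i) (V j))

        walk : IsGraphWalk G Sh Γ ω ζ
        walk e = s e , adjacent-increment G (adjacent e) , Lifting.base-edge (lift e)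

  snake-reduction : ManyOneReduces (HasBiInfiniteSnake G) (HasBiInfiniteSnake H)
  snake-reduction = LiftedGraph.liftedGraph M , λ Γ → mk⇔ (lift Γ) (project Γ)
    where
      lift : ∀ Γ → HasBiInfiniteSnake G Γ → HasBiInfiniteSnake H (LiftedGraph.liftedGraph M Γ)
      lift Γ (ω , ζ , injective , walk) =
        let ω' , ζ' , same , walk' = lift-walk ℤ-line Γ {ω} {ζ} walk
        in ω' , ζ' , (λ i j → injective i j ∘ Equivalence.from (same i j)) , walk'

      project : ∀ Γ → HasBiInfiniteSnake H (LiftedGraph.liftedGraph M Γ) → HasBiInfiniteSnake G Γ
      project Γ (ω' , ζ' , injective , walk') =
        let ω , ζ , same , walk = project-walk ℤ-line Γ {ω'} {ζ'} walk'
        in ω , ζ , (λ i j → injective i j ∘ Equivalence.to (same i j)) , walk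

  ouroboros-reduction : ManyOneReduces (HasOuroboros G) (HasOuroboros H)
  ouroboros-reduction = LiftedGraph.liftedGraph M , λ Γ → mk⇔ (lift Γ) (project Γ)
    where
      lift : ∀ Γ → HasOuroboros G Γ → HasOuroboros H (LiftedGraph.liftedGraph M Γ)
      lift Γ (suc (suc m) , 2≤n@(s≤s (s≤s z≤n)) , ω , ζ , closes , injective , walk) =
        let ω' , ζ' , same , walk' = lift-walk (segment (suc m)) Γ {ω} {ζ} walk
        in suc (suc m) , 2≤n , ω' , ζ' , Equivalence.to (same _ _) closes ,
           (λ i j → injective i j ∘ Equivalence.from (same i j)) , walk'

      project : ∀ Γ → HasOuroboros H (LiftedGraph.liftedGraph M Γ) → HasOuroboros G Γ
      project Γ (suc (suc m) , 2≤n@(s≤s (s≤s z≤n)) , ω' , ζ' , closes , injective , walk') =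
        let ω , ζ , same , walk = project-walk (segment (suc m)) Γ {ω'} {ζ'} walk'
        in suc (suc m) , 2≤n , ω , ζ , Equivalence.from (same _ _) closes ,
           (λ i j → injective i j ∘ Equivalence.to (same i j)) , walk

proposition7 : ∀ {c ℓ c' ℓ'} (G : GenGroup c ℓ) (H : GenGroup c' ℓ')
    (φ : GenGroup.Elt G → GenGroup.Elt H) → IsSnakeEmbedding G H φ →
    ManyOneReduces (HasBiInfiniteSnake G) (HasBiInfiniteSnake H)
    × ManyOneReduces (HasOuroboros G) (HasOuroboros H)
proposition7 G H φ embedding = snake-reduction , ouroboros-reduction
  where open SnakeTransfer G H φ embedding
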